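{- For $n\ge 4$ let $m(n)$ be the minimum of $\operatorname{th}_{\operatorname{Z}}(G)\cdot\operatorname{th}_{\operatorname{Z}}(\overline G)$ over all graphs $G$ of order $n$, and let $m_c(n)$ be the minimum of the same product over all graphs $G$ of order $n$ such that both $G$ and its complement $\overline G$ are connected. Then $m(n)=\Theta(n^{3/2})$ and $m_c(n)=\Theta(n^{3/2})$.
   Context: Graphs are finite, simple, undirected, with nonempty vertex set; the order of $G$ is $|V(G)|$; $\overline G$ is the complement of $G$. Standard zero forcing: each vertex is filled or unfilled. Color change rule: if $w$ is the unique unfilled neighbor of a filled vertex $v$, then fill $w$. For $B\subseteq V(G)$ put $B^{[0]}=B$, and let $B^{[i+1]}$ be $B^{[i]}$ together with all vertices that can be filled by one application of the rule when exactly the vertices of $B^{[i]}$ are filled. $\operatorname{pt}_{\operatorname{Z}}(G;B)$ is the least $t$ with $B^{[t]}=V(G)$ ($\infty$ if none exists), and $\operatorname{pt}_{\operatorname{Z}}(G,k)=\min_{|B|=k}\operatorname{pt}_{\operatorname{Z}}(G;B)$. The sum throttling number of $G$ of order $n$ is $\operatorname{th}_{\operatorname{Z}}(G)=\min_{1\le k\le n}(k+\operatorname{pt}_{\operatorname{Z}}(G,k))$. $f=\Theta(g)$ means there are positive constants $c,C,k$ with $c\,g(n)\le f(n)\le C\,g(n)$ for all $n\ge k$. -}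

module Defs where

open import Data.Fin using (Fin)
open import Data.Fin.Properties using () renaming (_≟_ to _≟ᶠ_)
open import Data.Fin.Subset using (Subset; _∈_; ∣_∣)
open import Data.Integer using (+_)
open import Data.Nat using (ℕ; zero; suc; _+_; _*_; _^_; _≤_; _<_)
open import Data.Product using (_×_; _,_; ∃-syntax; Σ-syntax)
open import Data.Rational as ℚ using (ℚ; 0ℚ; 1ℚ; _/_)
import Data.Rational.Properties as ℚ
open import Data.Sum using (_⊎_; inj₁; inj₂)
open import Level using (0ℓ)
open import Relation.Binary.Construct.Closure.ReflexiveTransitive using (Star)
open import Relation.Binary.Core using (Rel)
open import Relation.Binary.Definitions using (Decidable; Irreflexive; Symmetric)
open import Relation.Binary.PropositionalEquality using (_≡_; refl; sym; subst)
open import Relation.Nullary using (¬_; yes; no)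
open import Relation.Nullary.Decidable using (¬?; _×-dec_)
open import Relation.Unary using (Pred)

IsMinimum : ∀ {ℓ} → Pred ℕ ℓ → ℕ → Set ℓ
IsMinimum P m = P m × (∀ k → P k → m ≤ k)

-- A graph of order n, up to naming its vertices by Fin n.
record Graph (n : ℕ) : Set₁ where
  field
    _~_      : Rel (Fin n) 0ℓ
    _~?_     : Decidable _~_
    ~-sym    : Symmetric _~_
    ~-irrefl : Irreflexive _≡_ _~_

complement : ∀ {n} → Graph n → Graph n
complement G = record
  { _~_      = λ u v → ¬ (u ≡ v) × ¬ (u ~ v)
  ; _~?_     = λ u v → ¬? (u ≟ᶠ v) ×-dec ¬? (u ~? v)
  ; ~-sym    = λ (u≢v , u≁v) → (λ v≡u → u≢v (sym v≡u)) , (λ v~u → u≁v (~-sym v~u))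
  ; ~-irrefl = λ u≡v (u≢v , _) → u≢v u≡v
  }
  where open Graph G

-- Only used at positive order, so the nonemptiness requirement is not restated.
Connected : ∀ {n} → Graph n → Set
Connected G = ∀ u v → Star _~_ u v
  where open Graph G

module _ {n : ℕ} (G : Graph n) where
  open Graph G

  -- When exactly the vertices satisfying S are filled, the filled vertex v
  -- has w as its unique unfilled neighbour.
  Forces : Pred (Fin n) 0ℓ → Rel (Fin n) 0ℓ
  Forces S v w = S v × (v ~ w) × ¬ S w × (∀ x → v ~ x → ¬ S x → x ≡ w)

  Stage : Subset n → ℕ → Pred (Fin n) 0ℓ
  Stage B zero    w = w ∈ B
  Stage B (suc i) w = Stage B i w ⊎ (∃[ v ] Forces (Stage B i) v w)

  -- The propagation quantities take values in ℕ ∪ {∞}; the relations below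
  -- hold exactly when the quantity is the given finite value.  Infinite values
  -- are thus simply omitted from the minima, which does not change any finite
  -- minimum.  (The throttling number is finite for n ≥ 1, by taking B to be
  -- the whole vertex set.)
  IsPropagationTime : Subset n → ℕ → Set
  IsPropagationTime B = IsMinimum λ t → ∀ v → Stage B t v

  IsPropagationTimeOfSize : ℕ → ℕ → Set
  IsPropagationTimeOfSize k =
    IsMinimum λ t → Σ[ B ∈ Subset n ] (∣ B ∣ ≡ k × IsPropagationTime B t)

  IsThrottlingNumber : ℕ → Set
  IsThrottlingNumber = IsMinimum λ s →
    ∃[ k ] ∃[ t ] (1 ≤ k × k ≤ n × IsPropagationTimeOfSize k t × s ≡ k + t)

IsThrottlingProduct : ∀ {n} → Graph n → ℕ → Set
IsThrottlingProduct G p =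
  ∃[ a ] ∃[ b ] (IsThrottlingNumber G a × IsThrottlingNumber (complement G) b × p ≡ a * b)

IsMinProduct : ℕ → ℕ → Set₁
IsMinProduct n = IsMinimum λ p → Σ[ G ∈ Graph n ] IsThrottlingProduct G p

IsMinConnectedProduct : ℕ → ℕ → Set₁
IsMinConnectedProduct n = IsMinimum λ p →
  Σ[ G ∈ Graph n ] (Connected G × Connected (complement G) × IsThrottlingProduct G p)

-- Dedekind reals: Lower q means q < x, and Upper q means x < q.
record ℝ : Set₁ where
  field
    Lower Upper     : Pred ℚ 0ℓ
    lower-inhabited : ∃[ q ] Lower q
    upper-inhabited : ∃[ r ] Upper r
    lower-closed    : ∀ {p q} → p ℚ.< q → Lower q → Lower p
    upper-closed    : ∀ {q r} → q ℚ.< r → Upper q → Upper r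
    lower-open      : ∀ {q} → Lower q → ∃[ r ] (q ℚ.< r × Lower r)
    upper-open      : ∀ {r} → Upper r → ∃[ q ] (q ℚ.< r × Upper q)
    disjoint        : ∀ {q r} → Lower q → Upper r → q ℚ.< r
    located         : ∀ {q r} → q ℚ.< r → Lower q ⊎ Upper r

fromℕ : ℕ → ℚ
fromℕ n = + n / 1

private
  sq-mono-< : ∀ {p q} → 0ℚ ℚ.≤ p → p ℚ.< q → p ℚ.* p ℚ.< q ℚ.* q
  sq-mono-< {p} {q} 0≤p p<q = ℚ.≤-<-trans
    (ℚ.*-monoˡ-≤-nonNeg p {{ℚ.nonNegative 0≤p}} (ℚ.<⇒≤ p<q))
    (ℚ.*-monoˡ-<-pos q {{ℚ.positive (ℚ.≤-<-trans 0≤p p<q)}} p<q)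

  sq-cancel-≤ : ∀ {p q} → 0ℚ ℚ.≤ q → p ℚ.* p ℚ.≤ q ℚ.* q → p ℚ.≤ q
  sq-cancel-≤ 0≤q p²≤q² =
    ℚ.≮⇒≥ λ q<p → ℚ.<-irrefl refl (ℚ.<-≤-trans (sq-mono-< 0≤q q<p) p²≤q²)

  0≤fromℕ : ∀ a → 0ℚ ℚ.≤ fromℕ a
  0≤fromℕ a = ℚ.nonNegative⁻¹ (fromℕ a) {{ℚ.normalize-nonNeg a 1}}

  p<1+p : ∀ p → p ℚ.< 1ℚ ℚ.+ p
  p<1+p p = subst (ℚ._< 1ℚ ℚ.+ p) (ℚ.+-identityˡ p)
    (ℚ.+-monoˡ-< p (ℚ.positive⁻¹ 1ℚ))

  ≤-sq-suc : ∀ {x} → 0ℚ ℚ.≤ x → x ℚ.≤ (1ℚ ℚ.+ x) ℚ.* (1ℚ ℚ.+ x)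
  ≤-sq-suc {x} 0≤x = ℚ.≤-trans (ℚ.<⇒≤ (p<1+p x))
    (subst (ℚ._≤ y ℚ.* y) (ℚ.*-identityʳ y)
      (ℚ.*-monoˡ-≤-nonNeg y {{ℚ.nonNegative (ℚ.≤-trans 0≤1 1≤y)}} 1≤y))
    where
    y = 1ℚ ℚ.+ x
    0≤1 : 0ℚ ℚ.≤ 1ℚ
    0≤1 = ℚ.nonNegative⁻¹ 1ℚ
    1≤y : 1ℚ ℚ.≤ y
    1≤y = subst (ℚ._≤ y) (ℚ.+-identityʳ 1ℚ) (ℚ.+-monoʳ-≤ 1ℚ 0≤x)

√ : ℕ → ℝ
√ a = record
  { Lower = λ q → ∃[ p ] (0ℚ ℚ.≤ p × p ℚ.* p ℚ.≤ x × q ℚ.< p)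
  ; Upper = λ r → ∃[ p ] (0ℚ ℚ.≤ p × x ℚ.≤ p ℚ.* p × p ℚ.< r)
  ; lower-inhabited = ℚ.- 1ℚ , 0ℚ , ℚ.≤-refl , 0≤x , ℚ.negative⁻¹ (ℚ.- 1ℚ)
  ; upper-inhabited = 1ℚ ℚ.+ (1ℚ ℚ.+ x) , 1ℚ ℚ.+ x
      , ℚ.≤-trans 0≤x (ℚ.<⇒≤ (p<1+p x)) , ≤-sq-suc 0≤x , p<1+p (1ℚ ℚ.+ x)
  ; lower-closed = λ p<q (s , 0≤s , s²≤x , q<s) → s , 0≤s , s²≤x , ℚ.<-trans p<q q<s
  ; upper-closed = λ q<r (s , 0≤s , x≤s² , s<q) → s , 0≤s , x≤s² , ℚ.<-trans s<q q<r
  ; lower-open = λ (p , 0≤p , p²≤x , q<p) →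
      let (r , q<r , r<p) = ℚ.<-dense q<p in r , q<r , p , 0≤p , p²≤x , r<p
  ; upper-open = λ (p , 0≤p , x≤p² , p<r) →
      let (q , p<q , q<r) = ℚ.<-dense p<r in q , q<r , p , 0≤p , x≤p² , p<q
  ; disjoint = λ (p , _ , p²≤x , q<p) (s , 0≤s , x≤s² , s<r) →
      ℚ.<-trans q<p (ℚ.≤-<-trans (sq-cancel-≤ 0≤s (ℚ.≤-trans p²≤x x≤s²)) s<r)
  ; located = loc
  }
  where
  x = fromℕ a
  0≤x : 0ℚ ℚ.≤ x
  0≤x = 0≤fromℕ a
  loc : ∀ {q r} → q ℚ.< r →
        (∃[ p ] (0ℚ ℚ.≤ p × p ℚ.* p ℚ.≤ x × q ℚ.< p)) ⊎
        (∃[ p ] (0ℚ ℚ.≤ p × x ℚ.≤ p ℚ.* p × p ℚ.< r))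
  loc q<r with ℚ.<-dense q<r
  ... | p , q<p , p<r with 0ℚ ℚ.≤? p
  ...   | no 0≰p = inj₁ (0ℚ , ℚ.≤-refl , 0≤x , ℚ.<-trans q<p (ℚ.≰⇒> 0≰p))
  ...   | yes 0≤p with ℚ.≤-total (p ℚ.* p) x
  ...     | inj₁ p²≤x = inj₁ (p , 0≤p , p²≤x , q<p)
  ...     | inj₂ x≤p² = inj₂ (p , 0≤p , x≤p² , p<r)

-- Comparison of c · x with a rational y, for a positive rational factor c:
-- the lower and upper cuts of c · x are the images under q ↦ c * q of those of x.
infix 4 _·_≤ᴿ_ _≤ᴿ_·_

_·_≤ᴿ_ : ℚ → ℝ → ℚ → Set
c · x ≤ᴿ y = ∀ q → ℝ.Lower x q → c ℚ.* q ℚ.≤ y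

_≤ᴿ_·_ : ℚ → ℚ → ℝ → Set
y ≤ᴿ c · x = ∀ r → ℝ.Upper x r → y ℚ.≤ c ℚ.* r

-- Rational constants lose nothing: c may be decreased and C increased, as all
-- functions considered are nonnegative.
_=Θ_ : (ℕ → ℕ) → (ℕ → ℝ) → Set
f =Θ g = ∃[ c ] ∃[ C ] ∃[ k ]
  (0ℚ ℚ.< c × 0ℚ ℚ.< C × 0 < k ×
   (∀ n → k ≤ n → (c · g n ≤ᴿ fromℕ (f n)) × (fromℕ (f n) ≤ᴿ C · g n)))

_^3/2 : ℕ → ℝ
n ^3/2 = √ (n ^ 3)

{-# OPTIONS --safe #-}

-- Call a filled vertex active while it still has an unfilled neighbour.  Starting from k
-- filled vertices there are always at most k active ones, and at most k vertices are filled
-- per step.  Hence n ≤ k (1 + t), so th(G)² ≥ n.  Moreover, when about n/2 vertices are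
-- filled, the inactive filled set I and the unfilled set U have no edge between them, so the
-- complement contains a complete bipartite graph between I and U; there the same two bounds,
-- applied when the first side becomes full, show that one of I and U has at most 2k′
-- vertices.  This yields n ≤ 4 (k + k′), so one of the two throttling numbers is linear in n.
--
-- For the upper bound take a path, filling pairs of adjacent vertices at distance about √n;
-- its complement is handled by th ≤ n.

module Submission where

open import Defs
open import Data.Fin using (Fin; zero; suc; toℕ; fromℕ<; inject₁; combine; remQuot)
open import Data.Fin.Properties as Fin
  using (all?; any?; toℕ-injective; toℕ-inject₁; toℕ-fromℕ<; toℕ<n; remQuot-combine)
open import Data.Fin.Subset
  using (Subset; inside; outside; _∈_; _∉_; _⊆_; _⊃_; _∪_; _─_; _-_; ∁; ⊤; ⊥; ⁅_⁆; ∣_∣)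
open import Data.Fin.Subset.Induction using (⊃-wellFounded; Acc; acc)
open import Data.Fin.Subset.Properties
  using ( _∈?_; _⊆?_; anySubset?; ∣⊤∣≡n; ∣p∣≤n; ∣∁p∣≡n∸∣p∣; ∈⊤; ∉⊥; p⊆q⇒∣p∣≤∣q∣; x∈⁅x⁆
        ; x∈⁅y⁆⇒x≡y; x∈∁p⇒x∉p; x∈p∪q⁺; x∈p∪q⁻; p⊆p∪q; x∈p∧x∉q⇒x∈p─q; p─q⊆p
        ; x∈p∧x≢y⇒x∈p-y; x∈p⇒∣p-x∣<∣p∣)
open import Data.Integer as ℤ using (+≤+)
import Data.Integer.Properties as ℤ
open import Data.Nat
  using (ℕ; zero; suc; NonZero; >-nonZero⁻¹; _+_; _*_; _^_; _/_; _%_; _≤_; _<_; _≤?_; _≟_; z≤n; s≤s)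
open import Data.Nat.Coprimality as Coprimality using (1-coprimeTo)
open import Data.Nat.DivMod using (m≡m%n+[m/n]*n; m%n<n; m<n*o⇒m/o<n)
open import Data.Nat.Induction using (<-wellFounded)
open import Data.Nat.Properties
open import Data.Nat.Tactic.RingSolver using (solve-∀)
open import Data.Product using (_×_; _,_; proj₁; proj₂; ∃; ∃-syntax; Σ-syntax; uncurry; swap)
open import Data.Rational as ℚ using (ℚ; mkℚ; 0ℚ; 1ℚ)
import Data.Rational.Properties as ℚ
open import Data.Sum as Sum using (_⊎_; inj₁; inj₂; [_,_])
open import Data.Vec using ([]; _∷_; here; there; tabulate)
open import Data.Vec.Properties using (lookup∘tabulate; []=⇒lookup; lookup⇒[]=)
open import Function using (_∘_; id)
open import Level using (Level; 0ℓ)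
open import Relation.Binary.Construct.Closure.ReflexiveTransitive as Star using (Star; ε; _◅_; _◅◅_)
open import Relation.Binary.PropositionalEquality
  using (_≡_; _≢_; refl; sym; trans; cong; cong₂; subst)
open import Relation.Nullary using (¬_; Dec; yes; no; does; contradiction)
open import Relation.Nullary.Decidable using (map′; dec-true; _×-dec_; _⊎-dec_; ¬?; decidable-stable)
open import Relation.Unary using (Pred; Decidable)

private
  variable
    ℓ ℓ′ : Level
    k l m n : ℕ

-- Minima of decidable predicates

IsMinimum-unique : {P : Pred ℕ ℓ} → IsMinimum P k → IsMinimum P l → k ≡ l
IsMinimum-unique (Pk , k≤) (Pl , l≤) = ≤-antisym (k≤ _ Pl) (l≤ _ Pk)

IsMinimum-cong : {P : Pred ℕ ℓ} {Q : Pred ℕ ℓ′} →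
  (∀ {k} → P k → Q k) → (∀ {k} → Q k → P k) → IsMinimum P m → IsMinimum Q m
IsMinimum-cong P⇒Q Q⇒P (Pm , m≤) = P⇒Q Pm , λ k → m≤ k ∘ Q⇒P

isMinimum? : {P : Pred ℕ ℓ} → Decidable P → Decidable (IsMinimum P)
isMinimum? P? m with P? m | anyUpTo? P? m
... | no ¬Pm | _                   = no (¬Pm ∘ proj₁)
... | yes _  | yes (k , k<m , Pk)  = no λ (_ , m≤) → <⇒≱ k<m (m≤ k Pk)
... | yes Pm | no ¬below           = yes (Pm , λ k Pk → ≮⇒≥ λ k<m → ¬below (k , k<m , Pk))

-- Descent: whether a smaller witness exists is a bounded, hence decidable, search, and the descent
-- stops when there is none.
minimum : {P : Pred ℕ ℓ} → Decidable P → P k → ∃[ m ] (m ≤ k × IsMinimum P m)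
minimum {P = P} P? = go (<-wellFounded _)
  where
  go : ∀ {k} → Acc _<_ k → P k → ∃[ m ] (m ≤ k × IsMinimum P m)
  go {k} (acc rs) Pk with anyUpTo? P? k
  ... | no ¬below = k , ≤-refl , Pk , λ j Pj → ≮⇒≥ λ j<k → ¬below (j , j<k , Pj)
  ... | yes (j , j<k , Pj) =
    let m , m≤j , min = go (rs j<k) Pj in m , ≤-trans m≤j (<⇒≤ j<k) , min

-- A discrete intermediate value principle. It locates the step at which half of the vertices become
-- filled and the step at which one side of a bipartite pair becomes full.
crossing : {P : Pred ℕ ℓ} → Decidable P → ¬ P 0 → ∀ t → P t → ∃[ i ] (¬ P i × P (suc i))
crossing P? ¬P0 zero P0 = contradiction P0 ¬P0
crossing P? ¬P0 (suc t) Pt with P? t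
... | yes Pt′ = crossing P? ¬P0 t Pt′
... | no ¬Pt′ = t , ¬Pt′ , Pt

-- Finite sets and their cardinalities

⟦_⟧ : {P : Pred (Fin n) ℓ} → Decidable P → Subset n
⟦ P? ⟧ = tabulate (does ∘ P?)

module _ {P : Pred (Fin n) ℓ} (P? : Decidable P) {x : Fin n} where

  ∈⟦⟧⁺ : P x → x ∈ ⟦ P? ⟧
  ∈⟦⟧⁺ Px = lookup⇒[]= x _ (trans (lookup∘tabulate (does ∘ P?) x) (dec-true (P? x) Px))

  ∈⟦⟧⁻ : x ∈ ⟦ P? ⟧ → P x
  ∈⟦⟧⁻ x∈ with P? x | trans (sym (lookup∘tabulate (does ∘ P?) x)) ([]=⇒lookup x∈)
  ... | yes Px | _ = Px

∣p∪q∣≤∣p∣+∣q∣ : (p q : Subset n) → ∣ p ∪ q ∣ ≤ ∣ p ∣ + ∣ q ∣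
∣p∪q∣≤∣p∣+∣q∣ []            []            = z≤n
∣p∪q∣≤∣p∣+∣q∣ (outside ∷ p) (outside ∷ q) = ∣p∪q∣≤∣p∣+∣q∣ p q
∣p∪q∣≤∣p∣+∣q∣ (outside ∷ p) (inside  ∷ q) =
  ≤-trans (s≤s (∣p∪q∣≤∣p∣+∣q∣ p q)) (≤-reflexive (sym (+-suc ∣ p ∣ ∣ q ∣)))
∣p∪q∣≤∣p∣+∣q∣ (inside  ∷ p) (outside ∷ q) = s≤s (∣p∪q∣≤∣p∣+∣q∣ p q)
∣p∪q∣≤∣p∣+∣q∣ (inside  ∷ p) (inside  ∷ q) =
  s≤s (≤-trans (∣p∪q∣≤∣p∣+∣q∣ p q) (+-monoʳ-≤ ∣ p ∣ (n≤1+n ∣ q ∣)))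

p⊆q∪r⇒∣p∣≤∣q∣+∣r∣ : {p q r : Subset n} → (∀ {x} → x ∈ p → x ∈ q ⊎ x ∈ r) →
  ∣ p ∣ ≤ ∣ q ∣ + ∣ r ∣
p⊆q∪r⇒∣p∣≤∣q∣+∣r∣ {q = q} {r} f =
  ≤-trans (p⊆q⇒∣p∣≤∣q∣ (x∈p∪q⁺ ∘ f)) (∣p∪q∣≤∣p∣+∣q∣ q r)

x∈p─q⇒x∉q : {p q : Subset n} {x : Fin n} → x ∈ p ─ q → x ∉ q
x∈p─q⇒x∉q {p = _ ∷ _} {inside  ∷ _} (there x∈) (there x∈q) = x∈p─q⇒x∉q x∈ x∈q
x∈p─q⇒x∉q {p = _ ∷ _} {outside ∷ _} (there x∈) (there x∈q) = x∈p─q⇒x∉q x∈ x∈q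

-- The injection is a relation, since an image such as a forcing vertex is extracted from a
-- membership proof. Induction on `p` removes the image of each chosen element from `q`.
injection⇒∣p∣≤∣q∣ : (R : Fin m → Fin n → Set ℓ) (p : Subset m) (q : Subset n) →
  (∀ {x} → x ∈ p → ∃[ y ] (y ∈ q × R x y)) →
  (∀ {x x′ y} → R x y → R x′ y → x ≡ x′) →
  ∣ p ∣ ≤ ∣ q ∣
injection⇒∣p∣≤∣q∣ R []            q f inj = z≤n
injection⇒∣p∣≤∣q∣ R (outside ∷ p) q f inj =
  injection⇒∣p∣≤∣q∣ (R ∘ suc) p q (f ∘ there) λ r r′ → Fin.suc-injective (inj r r′)
injection⇒∣p∣≤∣q∣ R (inside ∷ p) q f inj with f here
... | y , y∈q , Rzy = ≤-trans
  (s≤s (injection⇒∣p∣≤∣q∣ (R ∘ suc) p (q - y) f′ λ r r′ → Fin.suc-injective (inj r r′)))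
  (x∈p⇒∣p-x∣<∣p∣ y∈q)
  where
  f′ : ∀ {x} → x ∈ p → ∃[ y′ ] (y′ ∈ q - y × R (suc x) y′)
  f′ x∈p with f (there x∈p)
  ... | y′ , y′∈q , Rxy′ = y′ , x∈p∧x≢y⇒x∈p-y y′∈q y′≢y , Rxy′
    where
    y′≢y : y′ ≢ y
    -- A shared image would identify `zero` with a successor.
    y′≢y refl with inj Rzy Rxy′
    ... | ()

-- Zero forcing

module _ {n : ℕ} (G : Graph n) where
  open Graph G

  Fills : Subset n → ℕ → Set
  Fills B t = ∀ v → Stage G B t v

  stage? : ∀ B i → Decidable (Stage G B i)
  stage? B zero    w = w ∈? B
  stage? B (suc i) w = stage? B i w ⊎-dec any? λ v →
    stage? B i v ×-dec (v ~? w) ×-dec ¬? (stage? B i w) ×-dec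
    -- Uniqueness is decided as the absence of an unfilled neighbour other than `w`.
    map′ (λ f x v~x ¬Sx → decidable-stable (x Fin.≟ w) λ x≢w → f (x , v~x , ¬Sx , x≢w))
         (λ f (x , v~x , ¬Sx , x≢w) → x≢w (f x v~x ¬Sx))
         (¬? (any? λ x → (v ~? x) ×-dec ¬? (stage? B i x) ×-dec ¬? (x Fin.≟ w)))

  fills? : ∀ B → Decidable (Fills B)
  fills? B t = all? (stage? B t)

  attainedBySize? : ∀ k → Decidable λ t →
    Σ[ B ∈ Subset n ] (∣ B ∣ ≡ k × IsPropagationTime G B t)
  attainedBySize? k t = anySubset? λ B → (∣ B ∣ ≟ k) ×-dec isMinimum? (fills? B) t

  isPropagationTimeOfSize? : ∀ k → Decidable (IsPropagationTimeOfSize G k)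
  isPropagationTimeOfSize? k = isMinimum? (attainedBySize? k)

  -- Minimise first over the times for `B`, then over all sets of the same size; neither step
  -- exceeds `t`.
  propagationTimeOfSize : ∀ {B t} → Fills B t →
    ∃[ t′ ] (t′ ≤ t × IsPropagationTimeOfSize G ∣ B ∣ t′)
  propagationTimeOfSize {B} fills =
    let t₁ , t₁≤t , min₁ = minimum (fills? B) fills
        t₂ , t₂≤t₁ , min₂ = minimum (attainedBySize? ∣ B ∣) (B , refl , min₁)
    in t₂ , ≤-trans t₂≤t₁ t₁≤t , min₂

  throttling-attained : ∀ {a} → IsThrottlingNumber G a →
    ∃[ B ] ∃[ t ] (1 ≤ ∣ B ∣ × Fills B t × a ≡ ∣ B ∣ + t)
  throttling-attained ((_ , t , 1≤k , _ , ((B , refl , fills , _) , _) , a≡) , _) =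
    B , t , 1≤k , fills , a≡

  throttling-≤ : ∀ {a B t} → IsThrottlingNumber G a → 1 ≤ ∣ B ∣ → Fills B t → a ≤ ∣ B ∣ + t
  throttling-≤ {B = B} (_ , a≤) 1≤∣B∣ fills =
    let t′ , t′≤t , prop = propagationTimeOfSize fills
    in ≤-trans (a≤ _ (∣ B ∣ , t′ , 1≤∣B∣ , ∣p∣≤n B , prop , refl)) (+-monoʳ-≤ ∣ B ∣ t′≤t)

  -- Fill every vertex at time 0.
  throttling-≤-order : ∀ {a} → 1 ≤ n → IsThrottlingNumber G a → a ≤ n
  throttling-≤-order 1≤n isTh = subst (_ ≤_) (trans (+-identityʳ _) (∣⊤∣≡n n))
    (throttling-≤ isTh (subst (1 ≤_) (sym (∣⊤∣≡n n)) 1≤n) λ v → ∈⊤)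

  throttlingNumber : 1 ≤ n → ∃ (IsThrottlingNumber G)
  throttlingNumber 1≤n =
    let t , _ , prop = propagationTimeOfSize {⊤} {0} λ v → ∈⊤
        a , _ , isTh = minimum witness?
          (∣ ⊤ {n} ∣ , t , subst (1 ≤_) (sym (∣⊤∣≡n n)) 1≤n , ∣p∣≤n (⊤ {n}) , prop , refl)
    in a , isTh
    where
    witness? : Decidable λ s →
      ∃[ k ] ∃[ t ] (1 ≤ k × k ≤ n × IsPropagationTimeOfSize G k t × s ≡ k + t)
    -- The search is finite: `k` is at most `n`, and `s ≡ k + t` bounds `t` by `s`.
    witness? s = map′
      (λ (k , _ , t , _ , w) → k , t , w)
      (λ (k , t , 1≤k , k≤n , prop , s≡) →
        k , s≤s k≤n , t , s≤s (subst (t ≤_) (sym s≡) (m≤n+m t k)) , 1≤k , k≤n , prop , s≡)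
      (anyUpTo? (λ k → anyUpTo? (λ t →
        (1 ≤? k) ×-dec (k ≤? n) ×-dec isPropagationTimeOfSize? k t ×-dec (s ≟ k + t))
        (suc s)) (suc n))

  -- Active vertices and growth of the filled set

  module _ (B : Subset n) where

    filled : ℕ → Subset n
    filled i = ⟦ stage? B i ⟧

    active? : ∀ i → Decidable λ v → Stage G B i v × ∃[ w ] (v ~ w × ¬ Stage G B i w)
    active? i v = stage? B i v ×-dec any? λ w → (v ~? w) ×-dec ¬? (stage? B i w)

    active : ℕ → Subset n
    active i = ⟦ active? i ⟧

    fresh : ℕ → Subset n
    fresh i = filled (suc i) ─ filled i

    -- A fresh vertex is charged to a vertex forcing it, which thereby stops being active.
    ∣active∣-step : ∀ i → ∣ active (suc i) ∣ ≤ ∣ active i ∣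
    ∣active∣-step i = injection⇒∣p∣≤∣q∣ Charged (active (suc i)) (active i)
      (λ {x} x∈ → charge (∈⟦⟧⁻ (active? (suc i)) {x} x∈)) injective
      where
      S = Stage G B i

      Active : Pred (Fin n) 0ℓ
      Active v = Stage G B (suc i) v × ∃[ w ] (v ~ w × ¬ Stage G B (suc i) w)

      -- Activity of `x` is part of the relation for the sake of injectivity: a vertex charged to
      -- itself is still active, so it cannot also have forced another vertex in this step.
      Charged : Fin n → Fin n → Set
      Charged x y = Active x × ((S x × x ≡ y) ⊎ Forces G S y x)

      charge : ∀ {x} → Active x → ∃[ y ] (y ∈ active i × Charged x y)
      charge {x} a@(inj₁ Sx , w , x~w , ¬Sw) =
        x , ∈⟦⟧⁺ (active? i) (Sx , w , x~w , ¬Sw ∘ inj₁) , a , inj₁ (Sx , refl)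
      charge {x} a@(inj₂ (v , F@(Sv , v~x , ¬Sx , _)) , _) =
        v , ∈⟦⟧⁺ (active? i) (Sv , x , v~x , ¬Sx) , a , inj₂ F

      forcer-inactive : ∀ {x y} → Forces G S y x → ¬ Active y
      -- A neighbour `w` of `y` unfilled after the step was unfilled before it, so it is `x` by
      -- uniqueness; but `y` has just filled `x`.
      forcer-inactive {x} {y} F@(_ , _ , _ , unique) (_ , w , y~w , ¬Sw) =
        ¬Sw (inj₂ (y , subst (Forces G S y) (sym (unique w y~w (¬Sw ∘ inj₁))) F))

      injective : ∀ {x x′ y} → Charged x y → Charged x′ y → x ≡ x′
      injective (_ , inj₁ (_ , refl)) (_ , inj₁ (_ , refl)) = refl
      injective (a , inj₁ (_ , refl)) (_ , inj₂ F) = contradiction a (forcer-inactive F)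
      injective (_ , inj₂ F) (a , inj₁ (_ , refl)) = contradiction a (forcer-inactive F)
      injective (_ , inj₂ (_ , y~x , ¬Sx , _)) (_ , inj₂ (_ , _ , _ , unique)) =
        unique _ y~x ¬Sx

    ∣active∣≤ : ∀ i → ∣ active i ∣ ≤ ∣ B ∣
    ∣active∣≤ zero    = p⊆q⇒∣p∣≤∣q∣ (λ x∈ → proj₁ (∈⟦⟧⁻ (active? 0) x∈))
    ∣active∣≤ (suc i) = ≤-trans (∣active∣-step i) (∣active∣≤ i)

    -- Every fresh vertex has a forcer that was active at stage `i`, and a vertex can force only its
    -- unique unfilled neighbour.
    ∣fresh∣≤ : ∀ i → ∣ fresh i ∣ ≤ ∣ B ∣
    ∣fresh∣≤ i = ≤-trans
      (injection⇒∣p∣≤∣q∣ (λ x y → Forces G (Stage G B i) y x) (fresh i) (active i) forcer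
        λ (_ , y~x , ¬Sx , _) (_ , _ , _ , unique) → unique _ y~x ¬Sx)
      (∣active∣≤ i)
      where
      forcer : ∀ {x} → x ∈ fresh i → ∃[ y ] (y ∈ active i × Forces G (Stage G B i) y x)
      forcer {x} x∈ with ∈⟦⟧⁻ (stage? B (suc i)) (p─q⊆p _ (filled i) x∈)
      ... | inj₂ (v , F@(Sv , v~x , ¬Sx , _)) = v , ∈⟦⟧⁺ (active? i) (Sv , x , v~x , ¬Sx) , F
      ... | inj₁ Sx = contradiction (∈⟦⟧⁺ (stage? B i) Sx) (x∈p─q⇒x∉q x∈)

    filled-suc : ∀ i {x} → x ∈ filled (suc i) → x ∈ filled i ⊎ x ∈ fresh i
    filled-suc i {x} x∈ with x ∈? filled i
    ... | yes x∈i = inj₁ x∈i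
    ... | no  x∉i = inj₂ (x∈p∧x∉q⇒x∈p─q x∈ x∉i)

    ∣filled∣-step : ∀ i → ∣ filled (suc i) ∣ ≤ ∣ filled i ∣ + ∣ B ∣
    ∣filled∣-step i = ≤-trans (p⊆q∪r⇒∣p∣≤∣q∣+∣r∣ (filled-suc i)) (+-monoʳ-≤ _ (∣fresh∣≤ i))

    ∣filled0∣≤ : ∣ filled 0 ∣ ≤ ∣ B ∣
    ∣filled0∣≤ = p⊆q⇒∣p∣≤∣q∣ (∈⟦⟧⁻ (stage? B 0))

    ∣filled∣≤ : ∀ i → ∣ filled i ∣ ≤ ∣ B ∣ * suc i
    ∣filled∣≤ zero    = ≤-trans ∣filled0∣≤ (≤-reflexive (sym (*-identityʳ ∣ B ∣)))
    ∣filled∣≤ (suc i) = begin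
      ∣ filled (suc i) ∣       ≤⟨ ∣filled∣-step i ⟩
      ∣ filled i ∣ + ∣ B ∣     ≤⟨ +-monoˡ-≤ ∣ B ∣ (∣filled∣≤ i) ⟩
      ∣ B ∣ * suc i + ∣ B ∣    ≡⟨ +-comm _ ∣ B ∣ ⟩
      ∣ B ∣ + ∣ B ∣ * suc i    ≡⟨ *-suc ∣ B ∣ (suc i) ⟨
      ∣ B ∣ * suc (suc i)      ∎
      where open ≤-Reasoning

    Fills⇒n≤∣filled∣ : ∀ {t} → Fills B t → n ≤ ∣ filled t ∣
    Fills⇒n≤∣filled∣ {t} fills = subst (_≤ ∣ filled t ∣) (∣⊤∣≡n n)
      (p⊆q⇒∣p∣≤∣q∣ {p = ⊤} λ {x} _ → ∈⟦⟧⁺ (stage? B t) (fills x))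

  throttling-sq : ∀ {a} → IsThrottlingNumber G a → n ≤ a * a
  throttling-sq isTh with throttling-attained isTh
  ... | B , t , 1≤∣B∣ , fills , refl = begin
    n                              ≤⟨ Fills⇒n≤∣filled∣ B fills ⟩
    ∣ filled B t ∣                 ≤⟨ ∣filled∣≤ B t ⟩
    -- `suc t ≤ ∣ B ∣ + t` because `B` is nonempty.
    ∣ B ∣ * suc t                  ≤⟨ *-mono-≤ (m≤m+n ∣ B ∣ t) (+-monoˡ-≤ t 1≤∣B∣) ⟩
    (∣ B ∣ + t) * (∣ B ∣ + t)      ∎
    where open ≤-Reasoning

  -- At a stage at which about half of the vertices are filled, the inactive filled vertices
  -- have no unfilled neighbour.
  balanced-separation : ∀ {B t} → Fills B t →
    ∃[ I ] ∃[ U ] ( n ≤ 2 * ∣ U ∣ × n ≤ 2 * ∣ I ∣ + 4 * ∣ B ∣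
                  × (∀ {x y} → x ∈ I → y ∈ U → Graph._~_ (complement G) x y))
  balanced-separation {B} {t} fills with n ≤? 2 * ∣ filled B 0 ∣
  -- If `B` already contains half of the vertices there is no crossing, but `n ≤ 4 * ∣ B ∣` holds
  -- outright, so `I` may be empty and `U` everything.
  ... | yes n≤ = ⊥ , ⊤
    , subst (λ z → n ≤ 2 * z) (sym (∣⊤∣≡n n)) (m≤m+n n _)
    , ≤-trans n≤ (≤-trans (*-mono-≤ (s≤s (s≤s (z≤n {2}))) (∣filled0∣≤ B))
        (m≤n+m (4 * ∣ B ∣) (2 * ∣ ⊥ {n} ∣)))
    , λ x∈⊥ → contradiction x∈⊥ ∉⊥
  ... | no n≰
    -- Less than half is filled at stage `i`, which makes `U` large, and at least half at the next
    -- stage. That step fills at most `∣ B ∣` vertices and discarding the active ones loses at most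
    -- `∣ B ∣` more; doubling gives the term `4 * ∣ B ∣`.
    with i , ¬half , half ← crossing (λ i → n ≤? 2 * ∣ filled B i ∣) n≰ t
                              (≤-trans (Fills⇒n≤∣filled∣ B fills) (m≤m+n _ _))
    = I , U , n≤2∣U∣ , n≤2∣I∣+4∣B∣ , nonadjacent
    where
    open ≤-Reasoning
    F = filled B i
    I = F ─ active B i
    U = ∁ F

    F⊆I∪active : ∀ {x} → x ∈ F → x ∈ I ⊎ x ∈ active B i
    F⊆I∪active {x} x∈F with x ∈? active B i
    ... | yes x∈A = inj₂ x∈A
    ... | no  x∉A = inj₁ (x∈p∧x∉q⇒x∈p─q x∈F x∉A)

    n≤2∣U∣ : n ≤ 2 * ∣ U ∣
    n≤2∣U∣ = +-cancelˡ-≤ (2 * ∣ F ∣) _ _ (begin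
      2 * ∣ F ∣ + n          ≤⟨ +-monoˡ-≤ n (<⇒≤ (≰⇒> ¬half)) ⟩
      n + n                  ≡⟨ cong₂ _+_ (sym n≡) (trans (sym n≡) (sym (+-identityʳ _))) ⟩
      2 * (∣ F ∣ + ∣ U ∣)    ≡⟨ *-distribˡ-+ 2 ∣ F ∣ ∣ U ∣ ⟩
      2 * ∣ F ∣ + 2 * ∣ U ∣  ∎)
      where
      n≡ : ∣ F ∣ + ∣ U ∣ ≡ n
      n≡ = trans (cong (∣ F ∣ +_) (∣∁p∣≡n∸∣p∣ F)) (m+[n∸m]≡n (∣p∣≤n F))

    n≤2∣I∣+4∣B∣ : n ≤ 2 * ∣ I ∣ + 4 * ∣ B ∣
    n≤2∣I∣+4∣B∣ = begin
      n                              ≤⟨ half ⟩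
      2 * ∣ filled B (suc i) ∣       ≤⟨ *-monoʳ-≤ 2 (∣filled∣-step B i) ⟩
      2 * (∣ F ∣ + ∣ B ∣)            ≤⟨ *-monoʳ-≤ 2 (+-monoˡ-≤ ∣ B ∣
                                          (p⊆q∪r⇒∣p∣≤∣q∣+∣r∣ {p = F} {I} F⊆I∪active)) ⟩
      2 * (∣ I ∣ + ∣ active B i ∣ + ∣ B ∣)
        ≤⟨ *-monoʳ-≤ 2 (+-monoˡ-≤ ∣ B ∣ (+-monoʳ-≤ ∣ I ∣ (∣active∣≤ B i))) ⟩
      2 * (∣ I ∣ + ∣ B ∣ + ∣ B ∣)    ≡⟨ arith ∣ I ∣ ∣ B ∣ ⟩
      2 * ∣ I ∣ + 4 * ∣ B ∣          ∎
      where
      arith : ∀ x y → 2 * (x + y + y) ≡ 2 * x + 4 * y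
      arith = solve-∀

    nonadjacent : ∀ {x y} → x ∈ I → y ∈ U → ¬ x ≡ y × ¬ x ~ y
    nonadjacent {x} {y} x∈I y∈U =
      (λ { refl → x∈∁p⇒x∉p y∈U x∈F }) , λ x~y → x∈p─q⇒x∉q x∈I
        (∈⟦⟧⁺ (active? B i)
          (∈⟦⟧⁻ (stage? B i) x∈F , y , x~y , λ Sy → x∈∁p⇒x∉p y∈U (∈⟦⟧⁺ (stage? B i) Sy)))
      where
      x∈F : x ∈ F
      x∈F = p─q⊆p F (active B i) x∈I

  -- As long as neither side is completely filled, all filled vertices of both sides are active.
  complete-bipartite : ∀ {B t I U} → Fills B t → (∀ {x y} → x ∈ I → y ∈ U → x ~ y) →
    ∣ I ∣ ≤ 2 * ∣ B ∣ ⊎ ∣ U ∣ ≤ 2 * ∣ B ∣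
  complete-bipartite {B} {t} {I} {U} fills adjacent = result
    where
    Done : Pred ℕ 0ℓ
    Done i = I ⊆ filled B i ⊎ U ⊆ filled B i

    done? : Decidable Done
    done? i = (I ⊆? filled B i) ⊎-dec (U ⊆? filled B i)

    -- A vertex of `P` filled at stage `i` is adjacent to an unfilled vertex of `Q`, hence active;
    -- the rest of `P` is fresh. Both classes have at most `∣ B ∣` elements.
    bound : ∀ {P Q i} → (∀ {x y} → x ∈ P → y ∈ Q → x ~ y) →
      ¬ Q ⊆ filled B i → P ⊆ filled B (suc i) → ∣ P ∣ ≤ 2 * ∣ B ∣
    bound {P} {Q} {i} adj Q⊈ P⊆ = begin
      ∣ P ∣                          ≤⟨ p⊆q∪r⇒∣p∣≤∣q∣+∣r∣ split ⟩
      ∣ active B i ∣ + ∣ fresh B i ∣ ≤⟨ +-mono-≤ (∣active∣≤ B i) (∣fresh∣≤ B i) ⟩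
      ∣ B ∣ + ∣ B ∣                  ≡⟨ cong (∣ B ∣ +_) (+-identityʳ ∣ B ∣) ⟨
      2 * ∣ B ∣                      ∎
      where
      open ≤-Reasoning
      split : ∀ {x} → x ∈ P → x ∈ active B i ⊎ x ∈ fresh B i
      split {x} x∈P with filled-suc B i (P⊆ x∈P)
      ... | inj₂ x∈N = inj₂ x∈N
      ... | inj₁ x∈F with x ∈? active B i
      ...   | yes x∈A = inj₁ x∈A
      ...   | no  x∉A = contradiction (λ {y} → Q⊆ {y}) Q⊈
        where
        Q⊆ : Q ⊆ filled B i
        Q⊆ {y} y∈Q = decidable-stable (y ∈? filled B i) λ y∉F → x∉A
          (∈⟦⟧⁺ (active? B i)
            (∈⟦⟧⁻ (stage? B i) x∈F , y , adj x∈P y∈Q , λ Sy → y∉F (∈⟦⟧⁺ (stage? B i) Sy)))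

    initial : ∀ {P} → P ⊆ filled B 0 → ∣ P ∣ ≤ 2 * ∣ B ∣
    initial P⊆ = ≤-trans (p⊆q⇒∣p∣≤∣q∣ P⊆) (≤-trans (∣filled0∣≤ B) (m≤m+n _ _))

    result : ∣ I ∣ ≤ 2 * ∣ B ∣ ⊎ ∣ U ∣ ≤ 2 * ∣ B ∣
    result with done? 0
    ... | yes (inj₁ I⊆) = inj₁ (initial I⊆)
    ... | yes (inj₂ U⊆) = inj₂ (initial U⊆)
    ... | no ¬done with crossing done? ¬done t (inj₁ λ {x} _ → ∈⟦⟧⁺ (stage? B t) (fills x))
    ...   | i , ¬done-i , inj₁ I⊆ = inj₁ (bound adjacent (λ U⊆ → ¬done-i (inj₂ U⊆)) I⊆)
    ...   | i , ¬done-i , inj₂ U⊆ =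
      inj₂ (bound (λ x∈U y∈I → ~-sym (adjacent y∈I x∈U)) (λ I⊆ → ¬done-i (inj₁ I⊆)) U⊆)

-- The separated sets `I` and `U` of `G` are completely joined in the complement, so one of them has
-- at most `2 * ∣ B′ ∣` vertices. Inserting this into the matching size bound gives the claim; the
-- times enter only through `∣ B ∣ ≤ ∣ B ∣ + t`.
throttling-sum : {G : Graph n} {a b : ℕ} →
  IsThrottlingNumber G a → IsThrottlingNumber (complement G) b → n ≤ 4 * (a + b)
throttling-sum {n} {G} isThG isThḠ with throttling-attained G isThG | throttling-attained _ isThḠ
... | B , t , _ , fills , refl | B′ , t′ , _ , fills′ , refl =
  ≤-trans zero-forcing-sum (*-monoʳ-≤ 4 (+-mono-≤ (m≤m+n ∣ B ∣ t) (m≤m+n ∣ B′ ∣ t′)))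
  where
  open ≤-Reasoning
  arith : ∀ x y → 2 * (2 * y) + 4 * x ≡ 4 * (x + y)
  arith = solve-∀

  zero-forcing-sum : n ≤ 4 * (∣ B ∣ + ∣ B′ ∣)
  zero-forcing-sum with balanced-separation G fills
  ... | I , U , n≤U , n≤I , adjacent with complete-bipartite (complement G) fills′ adjacent
  ...   | inj₁ I≤ = begin
    n                              ≤⟨ n≤I ⟩
    2 * ∣ I ∣ + 4 * ∣ B ∣          ≤⟨ +-monoˡ-≤ _ (*-monoʳ-≤ 2 I≤) ⟩
    2 * (2 * ∣ B′ ∣) + 4 * ∣ B ∣   ≡⟨ arith ∣ B ∣ ∣ B′ ∣ ⟩
    4 * (∣ B ∣ + ∣ B′ ∣)           ∎
  ...   | inj₂ U≤ = begin
    n                              ≤⟨ n≤U ⟩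
    2 * ∣ U ∣                      ≤⟨ *-monoʳ-≤ 2 U≤ ⟩
    2 * (2 * ∣ B′ ∣)               ≤⟨ m≤m+n _ _ ⟩
    2 * (2 * ∣ B′ ∣) + 4 * ∣ B ∣   ≡⟨ arith ∣ B ∣ ∣ B′ ∣ ⟩
    4 * (∣ B ∣ + ∣ B′ ∣)           ∎

-- Lower bound for the product

n^3≡ : ∀ n → n ^ 3 ≡ n * (n * n)
n^3≡ n = cong (λ z → n * (n * z)) (*-identityʳ n)

-- The larger of `a` and `b` is at least n/8 and the smaller at least √n. Squaring keeps the
-- estimate within the natural numbers.
sq-product-bound : ∀ n a b → n ≤ a * a → n ≤ b * b → n ≤ 4 * (a + b) →
  n ^ 3 ≤ (8 * (a * b)) * (8 * (a * b))
sq-product-bound n a b n≤a² n≤b² n≤4[a+b] with ≤-total a b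
... | inj₁ a≤b = begin
  n ^ 3                              ≡⟨ n^3≡ n ⟩
  n * (n * n)                        ≤⟨ *-mono-≤ n≤a² (*-mono-≤ n≤8b n≤8b) ⟩
  a * a * (8 * b * (8 * b))          ≡⟨ arith a b ⟩
  (8 * (a * b)) * (8 * (a * b))      ∎
  where
  open ≤-Reasoning
  arith : ∀ a b → a * a * (8 * b * (8 * b)) ≡ (8 * (a * b)) * (8 * (a * b))
  arith = solve-∀
  double : ∀ b → 4 * (b + b) ≡ 8 * b
  double = solve-∀
  n≤8b : n ≤ 8 * b
  n≤8b = ≤-trans n≤4[a+b] (≤-trans (*-monoʳ-≤ 4 (+-monoˡ-≤ b a≤b)) (≤-reflexive (double b)))
... | inj₂ b≤a = begin
  n ^ 3                              ≡⟨ n^3≡ n ⟩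
  n * (n * n)                        ≤⟨ *-mono-≤ n≤b² (*-mono-≤ n≤8a n≤8a) ⟩
  b * b * (8 * a * (8 * a))          ≡⟨ arith a b ⟩
  (8 * (a * b)) * (8 * (a * b))      ∎
  where
  open ≤-Reasoning
  arith : ∀ a b → b * b * (8 * a * (8 * a)) ≡ (8 * (a * b)) * (8 * (a * b))
  arith = solve-∀
  double : ∀ a → 4 * (a + a) ≡ 8 * a
  double = solve-∀
  n≤8a : n ≤ 8 * a
  n≤8a = ≤-trans n≤4[a+b] (≤-trans (*-monoʳ-≤ 4 (+-monoʳ-≤ a b≤a)) (≤-reflexive (double a)))

throttling-product-lower : {G : Graph n} {p : ℕ} → IsThrottlingProduct G p →
  n ^ 3 ≤ (8 * p) * (8 * p)
throttling-product-lower {n} {G} (a , b , isThG , isThḠ , refl) = sq-product-bound n a b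
  (throttling-sq G isThG) (throttling-sq (complement G) isThḠ) (throttling-sum isThG isThḠ)

-- Paths

path : ∀ n → Graph n
path n = record
  { _~_      = λ u v → suc (toℕ u) ≡ toℕ v ⊎ suc (toℕ v) ≡ toℕ u
  ; _~?_     = λ u v → (suc (toℕ u) ≟ toℕ v) ⊎-dec (suc (toℕ v) ≟ toℕ u)
  ; ~-sym    = Sum.swap
  ; ~-irrefl = λ { refl → [ 1+n≢n , 1+n≢n ] }
  }

connected-to-zero : (G : Graph (suc n)) → (∀ v → Star (Graph._~_ G) v zero) → Connected G
connected-to-zero G to0 u v = to0 u ◅◅ Star.reverse (Graph.~-sym G) (to0 v)

path-connected : ∀ n → Connected (path (suc n))
path-connected n = connected-to-zero (path (suc n)) λ v → descend (toℕ v) v refl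
  where
  descend : ∀ k v → toℕ v ≡ k → Star (Graph._~_ (path (suc n))) v zero
  descend k       zero    _ = ε
  descend (suc k) (suc v) e =
    inj₂ (cong suc (toℕ-inject₁ v)) ◅
    descend k (inject₁ v) (trans (toℕ-inject₁ v) (suc-injective e))

-- In the complement, every vertex from 2 on is adjacent to 0, and 1 reaches 0 through 3. The fourth
-- vertex accounts for the restriction to order at least 4.
complement-path-connected : ∀ n → Connected (complement (path (4 + n)))
complement-path-connected n = connected-to-zero (complement (path (4 + n))) to0
  where
  3→0 : Graph._~_ (complement (path (4 + n))) (suc (suc (suc zero))) zero
  3→0 = (λ ()) , [ (λ ()) , (λ ()) ]
  to0 : ∀ v → Star (Graph._~_ (complement (path (4 + n)))) v zero
  to0 zero          = ε
  to0 (suc zero)    = ((λ ()) , [ (λ ()) , (λ ()) ]) ◅ 3→0 ◅ ε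
  to0 (suc (suc v)) = ((λ ()) , [ (λ ()) , (λ ()) ]) ◅ ε

-- The path is covered by `r` blocks of length `r`, and the seeds are the vertices at `q * r` and
-- `q * r + 1` for `q < r`. Positions beyond the end of the path are dropped, so there are at most
-- `r * 2` seeds.
module PathForcing {n r : ℕ} .{{_ : NonZero r}} (n<r*r : n < r * r) where

  position : Fin (r * 2) → ℕ
  position y = let q , e = remQuot {r} 2 y in toℕ e + toℕ q * r

  seed? : Decidable λ (v : Fin n) → ∃[ y ] (toℕ v ≡ position y)
  seed? v = any? {r * 2} λ y → toℕ v ≟ position y

  seeds : Subset n
  seeds = ⟦ seed? ⟧

  ∣seeds∣≤ : ∣ seeds ∣ ≤ r * 2
  ∣seeds∣≤ = subst (∣ seeds ∣ ≤_) (∣⊤∣≡n (r * 2))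
    (injection⇒∣p∣≤∣q∣ (λ v y → toℕ v ≡ position y) seeds ⊤
      (λ v∈ → let y , eq = ∈⟦⟧⁻ seed? v∈ in y , ∈⊤ , eq)
      λ e e′ → toℕ-injective (trans e (sym e′)))

  -- Each seeded pair propagates to the right, one vertex per step. The vertex at offset `i + 2` is
  -- forced by the one at `i + 1`, whose other neighbour, at offset `i`, is already filled.
  stage-seeds : ∀ i (q : Fin r) e v → toℕ v ≡ e + toℕ q * r → e ≤ suc i → Stage (path n) seeds i v
  stage-seeds zero q e v v≡ e≤1 = ∈⟦⟧⁺ seed? (combine q e′ , trans v≡ eq)
    where
    e′ : Fin 2
    e′ = fromℕ< (s≤s e≤1)
    eq : e + toℕ q * r ≡ position (combine q e′)
    eq = trans (cong (_+ toℕ q * r) (sym (toℕ-fromℕ< (s≤s e≤1))))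
      (cong (λ (q , e) → toℕ e + toℕ q * r) (sym (remQuot-combine q e′)))
  stage-seeds (suc i) q e v v≡ e≤ with m≤n⇒m<n∨m≡n e≤ | stage? (path n) seeds i v
  ... | inj₁ (s≤s e≤′) | _      = inj₁ (stage-seeds i q e v v≡ e≤′)
  -- The vertex may have been filled already, for instance as a seed of the next block, and then it
  -- cannot be forced.
  ... | inj₂ _         | yes Sv = inj₁ Sv
  stage-seeds (suc i) q _ (suc v) v≡ _ | inj₂ refl | no ¬Sv =
    inj₂ (inject₁ v , stage-seeds i q (suc i) (inject₁ v) u≡ ≤-refl
      , inj₁ (cong suc (toℕ-inject₁ v)) , ¬Sv , unique)
    where
    u≡ : toℕ (inject₁ v) ≡ suc i + toℕ q * r
    u≡ = trans (toℕ-inject₁ v) (suc-injective v≡)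
    unique : ∀ x → Graph._~_ (path n) (inject₁ v) x → ¬ Stage (path n) seeds i x → x ≡ suc v
    unique x (inj₁ e) _ = toℕ-injective (trans (sym e) (cong suc (toℕ-inject₁ v)))
    unique x (inj₂ e) ¬Sx = contradiction
      (stage-seeds i q i x (suc-injective (trans e u≡)) (n≤1+n i)) ¬Sx

  -- Division by `r` yields block and offset; the offset is below `r`, so `r` steps suffice.
  fills-seeds : Fills (path n) seeds r
  fills-seeds v = stage-seeds r (fromℕ< v/r<r) (toℕ v % r) v
    (trans (m≡m%n+[m/n]*n (toℕ v) r)
      (cong (λ q → toℕ v % r + q * r) (sym (toℕ-fromℕ< v/r<r))))
    (≤-trans (<⇒≤ (m%n<n (toℕ v) r)) (n≤1+n r))
    where
    v/r<r : toℕ v / r < r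
    v/r<r = m<n*o⇒m/o<n (<-trans (toℕ<n v) n<r*r)

  1≤∣seeds∣ : 1 ≤ n → 1 ≤ ∣ seeds ∣
  1≤∣seeds∣ 1≤n = ≤-trans (s≤s z≤n) (x∈p⇒∣p-x∣<∣p∣ zeroth∈seeds)
    where
    0<r : 0 < r
    0<r = >-nonZero⁻¹ r
    zeroth∈seeds : fromℕ< 1≤n ∈ seeds
    zeroth∈seeds = stage-seeds 0 (fromℕ< 0<r) 0 (fromℕ< 1≤n)
      (trans (toℕ-fromℕ< 1≤n) (cong (_* r) (sym (toℕ-fromℕ< 0<r)))) z≤n

  throttling-path : ∀ {a} → 1 ≤ n → IsThrottlingNumber (path n) a → a ≤ r * 2 + r
  throttling-path 1≤n isTh = ≤-trans
    (throttling-≤ (path n) {B = seeds} {r} isTh (1≤∣seeds∣ 1≤n) fills-seeds) (+-monoˡ-≤ r ∣seeds∣≤)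

-- `suc s` is the least number whose square exceeds `n`.
integer-sqrt : ∀ n → ∃[ s ] (s * s ≤ n × n < suc s * suc s)
integer-sqrt n with minimum {k = suc n} (λ r → suc n ≤? r * r) (m≤m*n (suc n) (suc n))
... | suc s , _ , n<r² , r≤ = s , ≮⇒≥ (λ n<s² → 1+n≰n (r≤ s n<s²)) , n<r²

-- Blocks of length `suc s`, at most `2 * s`, give the path a throttling number of at most
-- `3 * suc s`, hence at most `6 * s`, where `s` is the integer square root of `n`. The complement
-- contributes at most `n`.
path-product-upper : ∀ {p} → 1 ≤ n → IsThrottlingProduct (path n) p → p * p ≤ 36 * n ^ 3
path-product-upper {n} 1≤n (a , b , isThG , isThḠ , refl) with integer-sqrt n
... | zero  , _    , n<1  = contradiction 1≤n (<⇒≱ n<1)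
... | s@(suc s′) , s²≤n , n<r² = begin
  a * b * (a * b)                ≡⟨ regroup a b ⟩
  a * a * (b * b)                ≤⟨ *-mono-≤ (*-mono-≤ a≤6s a≤6s) (*-mono-≤ b≤n b≤n) ⟩
  6 * s * (6 * s) * (n * n)      ≡⟨ arith s n ⟩
  36 * (s * s * (n * n))         ≤⟨ *-monoʳ-≤ 36 (*-monoˡ-≤ (n * n) s²≤n) ⟩
  36 * (n * (n * n))             ≡⟨ cong (36 *_) (n^3≡ n) ⟨
  36 * n ^ 3                     ∎
  where
  open ≤-Reasoning
  regroup : ∀ a b → a * b * (a * b) ≡ a * a * (b * b)
  regroup = solve-∀
  arith : ∀ s n → 6 * s * (6 * s) * (n * n) ≡ 36 * (s * s * (n * n))
  arith = solve-∀
  triple : ∀ s → (2 * s) * 2 + 2 * s ≡ 6 * s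
  triple = solve-∀
  r≤2s : suc s ≤ 2 * s
  r≤2s = +-monoʳ-≤ 1 (≤-trans (m≤n+m s s′) (≤-reflexive (cong (s′ +_) (sym (+-identityʳ s)))))
  a≤6s : a ≤ 6 * s
  a≤6s = begin
    a                      ≤⟨ PathForcing.throttling-path {r = suc s} n<r² 1≤n isThG ⟩
    suc s * 2 + suc s      ≤⟨ +-mono-≤ (*-monoˡ-≤ 2 r≤2s) r≤2s ⟩
    (2 * s) * 2 + 2 * s    ≡⟨ triple s ⟩
    6 * s                  ∎
  b≤n : b ≤ n
  b≤n = throttling-≤-order (complement (path n)) 1≤n isThḠ

-- Existence of the minima

-- Adjacency is an arbitrary family of types, so logical equivalence takes the place of equality
-- when a graph is compared with one from a finite list.
_≈_ : Graph n → Graph n → Set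
G ≈ H = ∀ {u v} → (Graph._~_ G u v → Graph._~_ H u v) × (Graph._~_ H u v → Graph._~_ G u v)

≈-sym : {G H : Graph n} → G ≈ H → H ≈ G
≈-sym G≈H = swap G≈H

complement-cong : {G H : Graph n} → G ≈ H → complement G ≈ complement H
complement-cong G≈H =
  (λ (u≢v , ¬Guv) → u≢v , ¬Guv ∘ proj₂ G≈H) , (λ (u≢v , ¬Huv) → u≢v , ¬Huv ∘ proj₁ G≈H)

Connected-cong : {G H : Graph n} → G ≈ H → Connected G → Connected H
Connected-cong G≈H conn u v = Star.map (proj₁ G≈H) (conn u v)

module _ {n : ℕ} where

  -- `Forces` mentions `Stage` both positively and negatively, so the induction transports in both
  -- directions.
  Stage-cong : {G H : Graph n} → G ≈ H → ∀ {B} i {w} → Stage G B i w → Stage H B i w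
  Stage-cong G≈H zero    Sw = Sw
  Stage-cong G≈H (suc i) (inj₁ Sw) = inj₁ (Stage-cong G≈H i Sw)
  Stage-cong {G} {H} G≈H (suc i) (inj₂ (v , Sv , v~w , ¬Sw , unique)) = inj₂
    ( v , Stage-cong G≈H i Sv , proj₁ G≈H v~w , ¬Sw ∘ Stage-cong (≈-sym {G = G} {H} G≈H) i
    , λ x v~x ¬Sx → unique x (proj₂ G≈H v~x) (¬Sx ∘ Stage-cong G≈H i))

  IsThrottlingNumber-cong : {G H : Graph n} → G ≈ H → ∀ {a} →
    IsThrottlingNumber G a → IsThrottlingNumber H a
  IsThrottlingNumber-cong {G} {H} G≈H = IsMinimum-cong (number G≈H) (number H≈G)
    where
    H≈G : H ≈ G
    H≈G = ≈-sym {G = G} {H} G≈H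

    time : {G H : Graph n} → G ≈ H → ∀ {B t} → IsPropagationTime G B t → IsPropagationTime H B t
    time {G} {H} G≈H = IsMinimum-cong (λ {t} f v → Stage-cong G≈H t (f v))
      (λ {t} f v → Stage-cong (≈-sym {G = G} {H} G≈H) t (f v))

    timeOfSize : {G H : Graph n} → G ≈ H → ∀ {k t} →
      IsPropagationTimeOfSize G k t → IsPropagationTimeOfSize H k t
    timeOfSize {G} {H} G≈H = IsMinimum-cong
      (λ (B , e , p) → B , e , time G≈H p)
      (λ (B , e , p) → B , e , time (≈-sym {G = G} {H} G≈H) p)

    number : {G H : Graph n} → G ≈ H → ∀ {s} →
      ∃[ k ] ∃[ t ] (1 ≤ k × k ≤ n × IsPropagationTimeOfSize G k t × s ≡ k + t) →
      ∃[ k ] ∃[ t ] (1 ≤ k × k ≤ n × IsPropagationTimeOfSize H k t × s ≡ k + t)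
    number G≈H (k , t , 1≤k , k≤n , p , e) = k , t , 1≤k , k≤n , timeOfSize G≈H p , e

  IsThrottlingProduct-cong : {G H : Graph n} → G ≈ H → ∀ {p} →
    IsThrottlingProduct G p → IsThrottlingProduct H p
  IsThrottlingProduct-cong {G} {H} G≈H (a , b , isThG , isThḠ , e) =
    a , b , IsThrottlingNumber-cong G≈H isThG
    , IsThrottlingNumber-cong (complement-cong {G = G} {H} G≈H) isThḠ , e

  throttlingProduct : 1 ≤ n → (G : Graph n) → ∃ (IsThrottlingProduct G)
  throttlingProduct 1≤n G =
    let a , isThG = throttlingNumber G 1≤n
        b , isThḠ = throttlingNumber (complement G) 1≤n
    in a * b , a , b , isThG , isThḠ , refl

  IsThrottlingProduct-unique : {G : Graph n} {p q : ℕ} →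
    IsThrottlingProduct G p → IsThrottlingProduct G q → p ≡ q
  IsThrottlingProduct-unique (_ , _ , a , b , refl) (_ , _ , a′ , b′ , refl) =
    cong₂ _*_ (IsMinimum-unique a a′) (IsMinimum-unique b b′)

  -- The product exists and is unique, so it suffices to compare `p` with the computed value.
  isThrottlingProduct? : 1 ≤ n → (G : Graph n) → Decidable (IsThrottlingProduct G)
  isThrottlingProduct? 1≤n G p =
    let q , isProduct = throttlingProduct 1≤n G
    in map′ (λ { refl → isProduct }) (λ isProduct′ → IsThrottlingProduct-unique isProduct′ isProduct)
         (p ≟ q)

-- Decidability of connectedness

module _ (G : Graph n) where
  open Graph G

  -- Starting from `u` alone, add a neighbour outside the set while there is one; this ends because
  -- a finite set admits no infinite strictly increasing chain of subsets.
  component : ∀ u → ∃[ T ] (u ∈ T × (∀ {v} → v ∈ T → Star _~_ u v) × (∀ {x y} → x ∈ T → x ~ y → y ∈ T))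
  component u = grow (⊃-wellFounded ⁅ u ⁆) (x∈⁅x⁆ u)
    λ v∈ → subst (Star _~_ u) (sym (x∈⁅y⁆⇒x≡y u v∈)) ε
    where
    grow : ∀ {S} → Acc _⊃_ S → u ∈ S → (∀ {v} → v ∈ S → Star _~_ u v) →
      ∃[ T ] (u ∈ T × (∀ {v} → v ∈ T → Star _~_ u v) × (∀ {x y} → x ∈ T → x ~ y → y ∈ T))
    grow {S} (acc rs) u∈S reach
      with any? (λ x → any? (λ y → (x ∈? S) ×-dec (x ~? y) ×-dec ¬? (y ∈? S)))
    ... | no closed = S , u∈S , reach , λ {x} {y} x∈S x~y →
      decidable-stable (y ∈? S) λ y∉S → closed (x , y , x∈S , x~y , y∉S)
    ... | yes (x , y , x∈S , x~y , y∉S) =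
      grow (rs (p⊆p∪q ⁅ y ⁆ , y , x∈p∪q⁺ {p = S} (inj₂ (x∈⁅x⁆ y)) , y∉S)) (p⊆p∪q ⁅ y ⁆ u∈S) reach′
      where
      reach′ : ∀ {v} → v ∈ S ∪ ⁅ y ⁆ → Star _~_ u v
      reach′ v∈ with x∈p∪q⁻ S ⁅ y ⁆ v∈
      ... | inj₁ v∈S = reach v∈S
      ... | inj₂ v∈y rewrite x∈⁅y⁆⇒x≡y y v∈y = reach x∈S ◅◅ (x~y ◅ ε)

  connected? : Dec (Connected G)
  connected? = all? λ u → all? λ v →
    let T , u∈T , reach , closed = component u
        -- A walk starting in a set closed under adjacency never leaves it, so membership in `T`
        -- decides reachability from `u`.
        stays : ∀ {x y} → Star _~_ x y → x ∈ T → y ∈ T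
        stays = Star.fold (λ x y → x ∈ T → y ∈ T) (λ x~y f x∈T → f (closed x∈T x~y)) id
    in map′ reach (λ u⟶v → stays u⟶v u∈T) (v ∈? T)

-- Up to ≈, the graphs of order n are enumerated by their adjacency matrices.
decode : Subset (n * n) → Graph n
decode S = record
  { _~_      = λ u v → u ≢ v × combine u v ∈ S × combine v u ∈ S
  ; _~?_     = λ u v → ¬? (u Fin.≟ v) ×-dec (combine u v ∈? S) ×-dec (combine v u ∈? S)
  ; ~-sym    = λ (u≢v , uv , vu) → u≢v ∘ sym , vu , uv
  ; ~-irrefl = λ u≡v (u≢v , _) → u≢v u≡v
  }

encode : Graph n → Subset (n * n)
encode {n} G = ⟦ (λ i → uncurry (Graph._~?_ G) (remQuot n i)) ⟧

-- `decode` symmetrises the matrix and removes its diagonal, which changes nothing for the matrix of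
-- a graph.
decode-encode : (G : Graph n) → G ≈ decode (encode G)
decode-encode {n} G {u} {v} =
  (λ u~v → (λ u≡v → ~-irrefl u≡v u~v) , member u~v , member (~-sym u~v)) ,
  λ (_ , uv∈ , _) → subst (uncurry _~_) (remQuot-combine u v) (∈⟦⟧⁻ adjacent? uv∈)
  where
  open Graph G
  adjacent? : Decidable λ i → uncurry _~_ (remQuot {n} n i)
  adjacent? i = uncurry _~?_ (remQuot n i)
  member : ∀ {u v} → u ~ v → combine u v ∈ encode G
  member {u} {v} u~v = ∈⟦⟧⁺ adjacent? (subst (uncurry _~_) (sym (remQuot-combine u v)) u~v)

-- As `Q` respects `≈`, the existence of a suitable graph reduces to a finite search over adjacency
-- matrices, so the minimum can be found by descent.
minimum-over-graphs : (Q : Graph n → Pred ℕ 0ℓ) → (∀ G → Decidable (Q G)) →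
  (∀ {G H} → G ≈ H → ∀ {p} → Q G p → Q H p) →
  ∀ {G p} → Q G p → ∃ (IsMinimum λ p → Σ[ G ∈ Graph n ] Q G p)
minimum-over-graphs {n} Q Q? Q-cong {G} QGp =
  let m , _ , min = minimum search? (G , QGp) in m , min
  where
  search? : Decidable λ p → Σ[ G ∈ Graph n ] Q G p
  search? p = map′ (λ (S , q) → decode S , q)
    (λ (G , q) → encode G , Q-cong (decode-encode G) q) (anySubset? λ S → Q? (decode S) p)

extend : {Q : ℕ → Pred ℕ ℓ} → (∀ n → k ≤ n → ∃ (Q n)) → Σ[ f ∈ (ℕ → ℕ) ] (∀ n → k ≤ n → Q n (f n))
extend {k = k} {Q} ∃Q = f , f-spec
  where
  f : ℕ → ℕ
  f n with k ≤? n
  ... | yes k≤n = proj₁ (∃Q n k≤n)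
  -- An arbitrary default where nothing is prescribed.
  ... | no  _   = 0
  f-spec : ∀ n → k ≤ n → Q n (f n)
  f-spec n k≤n with k ≤? n
  ... | yes k≤n′ = proj₂ (∃Q n k≤n′)
  ... | no  k≰n  = contradiction k≤n k≰n

minProduct : ∀ n → 1 ≤ n → ∃ (IsMinProduct n)
minProduct n 1≤n = minimum-over-graphs IsThrottlingProduct (isThrottlingProduct? 1≤n)
  IsThrottlingProduct-cong (proj₂ (throttlingProduct 1≤n (path n)))

minConnectedProduct : ∀ n → 4 ≤ n → ∃ (IsMinConnectedProduct n)
minConnectedProduct (suc (suc (suc (suc n)))) (s≤s (s≤s (s≤s (s≤s z≤n)))) = minimum-over-graphs
  (λ G p → Connected G × Connected (complement G) × IsThrottlingProduct G p)
  (λ G p → connected? G ×-dec connected? (complement G) ×-dec isThrottlingProduct? 1≤4+n G p)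
  (λ {G} {H} G≈H (c , c̄ , p) → Connected-cong {G = G} {H} G≈H c
    , Connected-cong {G = complement G} {complement H} (complement-cong {G = G} {H} G≈H) c̄
    , IsThrottlingProduct-cong G≈H p)
  ( path-connected (3 + n) , complement-path-connected n
  , proj₂ (throttlingProduct 1≤4+n (path (4 + n))))
  where
  1≤4+n : 1 ≤ 4 + n
  1≤4+n = s≤s z≤n

minProduct-lower : IsMinProduct n m → n ^ 3 ≤ (8 * m) * (8 * m)
minProduct-lower ((_ , isProduct) , _) = throttling-product-lower isProduct

minConnectedProduct-lower : IsMinConnectedProduct n m → n ^ 3 ≤ (8 * m) * (8 * m)
minConnectedProduct-lower ((_ , _ , _ , isProduct) , _) = throttling-product-lower isProduct

minProduct-upper : 1 ≤ n → IsMinProduct n m → m * m ≤ 36 * n ^ 3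
minProduct-upper {n} 1≤n (_ , m≤) =
  let p , isProduct = throttlingProduct 1≤n (path n)
      m≤p = m≤ p (path n , isProduct)
  in ≤-trans (*-mono-≤ m≤p m≤p) (path-product-upper 1≤n isProduct)

minConnectedProduct-upper : 4 ≤ n → IsMinConnectedProduct n m → m * m ≤ 36 * n ^ 3
minConnectedProduct-upper {suc (suc (suc (suc n)))} (s≤s (s≤s (s≤s (s≤s z≤n)))) (_ , m≤) =
  let p , isProduct = throttlingProduct (s≤s z≤n) (path (4 + n))
      m≤p = m≤ p (path (4 + n) , path-connected (3 + n) , complement-path-connected n , isProduct)
  in ≤-trans (*-mono-≤ m≤p m≤p) (path-product-upper (s≤s z≤n) isProduct)

-- Asymptotics

-- The division by 1 in `fromℕ` normalises by a gcd, which is stuck for a variable `a`; this form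
-- exposes numerator and denominator.
fromℕ≡mkℚ : ∀ a → fromℕ a ≡ mkℚ (ℤ.+ a) 0 (Coprimality.sym (1-coprimeTo a))
fromℕ≡mkℚ a = ℚ.normalize-coprime (Coprimality.sym (1-coprimeTo a))

fromℕ-* : ∀ a b → fromℕ (a * b) ≡ fromℕ a ℚ.* fromℕ b
fromℕ-* a b rewrite fromℕ≡mkℚ a | fromℕ≡mkℚ b = cong (ℚ._/ 1) (ℤ.pos-* a b)

fromℕ-mono-≤ : k ≤ l → fromℕ k ℚ.≤ fromℕ l
fromℕ-mono-≤ {k} {l} k≤l rewrite fromℕ≡mkℚ k | fromℕ≡mkℚ l =
  ℚ.*≤* (ℤ.*-monoʳ-≤-nonNeg (ℤ.+ 1) (+≤+ k≤l))

0≤fromℕ : ∀ a → 0ℚ ℚ.≤ fromℕ a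
0≤fromℕ a = fromℕ-mono-≤ {0} {a} z≤n

sq-cancel-≤ : ∀ {p q} → 0ℚ ℚ.≤ q → p ℚ.* p ℚ.≤ q ℚ.* q → p ℚ.≤ q
sq-cancel-≤ {p} {q} 0≤q p²≤q² = ℚ.≮⇒≥ λ q<p → ℚ.<-irrefl refl (ℚ.<-≤-trans
  (ℚ.≤-<-trans (ℚ.*-monoˡ-≤-nonNeg q {{ℚ.nonNegative 0≤q}} (ℚ.<⇒≤ q<p))
    (ℚ.*-monoˡ-<-pos p {{ℚ.positive (ℚ.≤-<-trans 0≤q q<p)}} q<p)) p²≤q²)

-- The constants 1/8 and 6 are the square roots of those in the hypotheses. Each cut of the root
-- supplies a rational `p` whose square is compared with `g n`; then p² ≤ (8f)² or f² ≤ (6p)², and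
-- the squares are cancelled.
=Θ-√ : {f g : ℕ → ℕ} →
  (∀ n → 4 ≤ n → g n ≤ (8 * f n) * (8 * f n)) → (∀ n → 4 ≤ n → f n * f n ≤ 36 * g n) →
  f =Θ λ n → √ (g n)
=Θ-√ {f} {g} lower upper =
  c , fromℕ 6 , 4 , ℚ.positive⁻¹ c , ℚ.positive⁻¹ (fromℕ 6) , s≤s z≤n ,
  λ n 4≤n → below n 4≤n , above n 4≤n
  where
  open ℚ.≤-Reasoning
  c = ℤ.+ 1 ℚ./ 8

  below : ∀ n → 4 ≤ n → c · √ (g n) ≤ᴿ fromℕ (f n)
  below n 4≤n q (p , _ , p²≤g , q<p) = begin
    c ℚ.* q                        ≤⟨ ℚ.*-monoˡ-≤-nonNeg c (ℚ.<⇒≤ q<p) ⟩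
    c ℚ.* p                        ≤⟨ ℚ.*-monoˡ-≤-nonNeg c p≤8f ⟩
    c ℚ.* fromℕ (8 * f n)          ≡⟨ cong (c ℚ.*_) (fromℕ-* 8 (f n)) ⟩
    c ℚ.* (fromℕ 8 ℚ.* fromℕ (f n)) ≡⟨ ℚ.*-assoc c (fromℕ 8) (fromℕ (f n)) ⟨
    -- The product of `c` and `fromℕ 8` evaluates to `1ℚ`.
    1ℚ ℚ.* fromℕ (f n)             ≡⟨ ℚ.*-identityˡ (fromℕ (f n)) ⟩
    fromℕ (f n)                    ∎
    where
    p≤8f : p ℚ.≤ fromℕ (8 * f n)
    p≤8f = sq-cancel-≤ (0≤fromℕ (8 * f n)) (begin
      p ℚ.* p                                ≤⟨ p²≤g ⟩
      fromℕ (g n)                            ≤⟨ fromℕ-mono-≤ (lower n 4≤n) ⟩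
      fromℕ ((8 * f n) * (8 * f n))          ≡⟨ fromℕ-* (8 * f n) (8 * f n) ⟩
      fromℕ (8 * f n) ℚ.* fromℕ (8 * f n)    ∎)

  above : ∀ n → 4 ≤ n → fromℕ (f n) ≤ᴿ fromℕ 6 · √ (g n)
  above n 4≤n r (p , 0≤p , g≤p² , p<r) = begin
    fromℕ (f n)      ≤⟨ sq-cancel-≤ 0≤6p f²≤[6p]² ⟩
    fromℕ 6 ℚ.* p    ≤⟨ ℚ.*-monoˡ-≤-nonNeg (fromℕ 6) (ℚ.<⇒≤ p<r) ⟩
    fromℕ 6 ℚ.* r    ∎
    where
    0≤6p : 0ℚ ℚ.≤ fromℕ 6 ℚ.* p
    0≤6p = ℚ.*-monoˡ-≤-nonNeg (fromℕ 6) 0≤p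
    interchange : fromℕ 36 ℚ.* (p ℚ.* p) ≡ fromℕ 6 ℚ.* p ℚ.* (fromℕ 6 ℚ.* p)
    interchange = begin-equality
      -- `fromℕ 36` and `fromℕ 6 ℚ.* fromℕ 6` agree by evaluation.
      fromℕ 6 ℚ.* fromℕ 6 ℚ.* (p ℚ.* p)      ≡⟨ ℚ.*-assoc (fromℕ 6) (fromℕ 6) (p ℚ.* p) ⟩
      fromℕ 6 ℚ.* (fromℕ 6 ℚ.* (p ℚ.* p))    ≡⟨ cong (fromℕ 6 ℚ.*_) (ℚ.*-assoc (fromℕ 6) p p) ⟨
      fromℕ 6 ℚ.* (fromℕ 6 ℚ.* p ℚ.* p)      ≡⟨ cong (fromℕ 6 ℚ.*_) (ℚ.*-comm (fromℕ 6 ℚ.* p) p) ⟩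
      fromℕ 6 ℚ.* (p ℚ.* (fromℕ 6 ℚ.* p))    ≡⟨ ℚ.*-assoc (fromℕ 6) p (fromℕ 6 ℚ.* p) ⟨
      fromℕ 6 ℚ.* p ℚ.* (fromℕ 6 ℚ.* p)      ∎
    f²≤[6p]² : fromℕ (f n) ℚ.* fromℕ (f n) ℚ.≤ fromℕ 6 ℚ.* p ℚ.* (fromℕ 6 ℚ.* p)
    f²≤[6p]² = begin
      fromℕ (f n) ℚ.* fromℕ (f n)            ≡⟨ fromℕ-* (f n) (f n) ⟨
      fromℕ (f n * f n)                      ≤⟨ fromℕ-mono-≤ (upper n 4≤n) ⟩
      fromℕ (36 * g n)                       ≡⟨ fromℕ-* 36 (g n) ⟩
      fromℕ 36 ℚ.* fromℕ (g n)               ≤⟨ ℚ.*-monoˡ-≤-nonNeg (fromℕ 36) g≤p² ⟩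
      fromℕ 36 ℚ.* (p ℚ.* p)                 ≡⟨ interchange ⟩
      fromℕ 6 ℚ.* p ℚ.* (fromℕ 6 ℚ.* p)      ∎

corollary2p8 : Σ[ m ∈ (ℕ → ℕ) ] Σ[ mc ∈ (ℕ → ℕ) ]
    ( (∀ n → 4 ≤ n → IsMinProduct n (m n))
    × (∀ n → 4 ≤ n → IsMinConnectedProduct n (mc n))
    × (m =Θ _^3/2)
    × (mc =Θ _^3/2) )
corollary2p8 =
  let m  , m-min  = extend {k = 4} λ n 4≤n → minProduct n (≤-trans (s≤s z≤n) 4≤n)
      mc , mc-min = extend minConnectedProduct
  in m , mc , m-min , mc-min
   , =Θ-√ {m} {_^ 3} (λ n 4≤n → minProduct-lower (m-min n 4≤n))
          (λ n 4≤n → minProduct-upper (≤-trans (s≤s z≤n) 4≤n) (m-min n 4≤n))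
   , =Θ-√ {mc} {_^ 3} (λ n 4≤n → minConnectedProduct-lower (mc-min n 4≤n))
          (λ n 4≤n → minConnectedProduct-upper 4≤n (mc-min n 4≤n))
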